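{- Let $\mathbf{X}$ be a category with pullbacks and let $(\mathcal{M},\mathcal{N})$ be a preadhesive structure on $\mathbf{X}$. Suppose that every split monomorphism of $\mathbf{X}$ is in $\mathcal{M}\cap\mathcal{N}$, that every arrow in $\mathcal{M}$ is $\mathcal{N}$-adhesive, and that $\mathcal{M}$ is closed under $\mathcal{M},\mathcal{N}$-unions. Then $\mathbf{X}$ is $\mathcal{M},\mathcal{N}$-adhesive.
   Context: Classes of arrows. A class $\mathcal{A}$ of arrows is stable under pullbacks (resp. pushouts) if for every pullback (resp. pushout) square with $f:A\to B$, $m:A\to C$, $n:B\to D$, $g:C\to D$, $n\circ f=g\circ m$, $n\in\mathcal{A}$ implies $m\in\mathcal{A}$ (resp. $m\in\mathcal{A}$ implies $n\in\mathcal{A}$); existence of the (co)limits is not assumed. $\mathcal{A}$ is closed under $\mathcal{B}$-decomposition if $g\circ f\in\mathcal{A}$ and $g\in\mathcal{B}$ imply $f\in\mathcal{A}$; closed under decomposition means closed under $\mathcal{A}$-decomposition. Preadhesive structure. A pair $(\mathcal{M},\mathcal{N})$ with $\mathcal{M}$ a class of monomorphisms and $\mathcal{N}$ a class of arrows of $\mathbf{X}$ such that: (1) $\mathcal{M}$ and $\mathcal{N}$ contain all isomorphisms and are closed under composition and decomposition; (2) $\mathcal{N}$ is closed under $\mathcal{M}$-decomposition; (3) $\mathcal{M}$ and $\mathcal{N}$ are stable under pullbacks and pushouts. Stable and Van Kampen squares. A pushout square $g:A\to B$, $m:A\to C$, $n:B\to D$, $f:C\to D$ is Van Kampen if for every commutative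 cube having it as bottom face, with top face $g':A'\to B'$, $m':A'\to C'$, $n':B'\to D'$, $f':C'\to D'$ and vertical arrows $a:A'\to A$, $b:B'\to B$, $c:C'\to C$, $d:D'\to D$, such that the two vertical faces containing $a$ are pullbacks, the top face is a pushout if and only if the two vertical faces containing $d$ are pullbacks. It is stable if the "if" half holds (the two faces containing $d$ being pullbacks implies the top face is a pushout). $\mathcal{M},\mathcal{N}$-adhesivity. $\mathbf{X}$ is $\mathcal{M},\mathcal{N}$-adhesive if $(\mathcal{M},\mathcal{N})$ is a preadhesive structure and: (1) pullbacks of arrows in $\mathcal{M}$ along arbitrary arrows exist; (2) for $m:X\to Y$ in $\mathcal{M}$ and $n:X\to Z$ in $\mathcal{N}$ a pushout of $m$ and $n$ exists (an $\mathcal{M},\mathcal{N}$-pushout); (3) $\mathcal{M},\mathcal{N}$-pushouts are Van Kampen squares. $\mathcal{N}$-adhesive arrows. An arrow $m:X\to Y$ is $\mathcal{N}$-preadhesive if for every $n:X\to Z$ in $\mathcal{N}$ a stable pushout square of $m$ along $n$ exists and it is also a pullback square. It is $\mathcal{N}$-adhesive if all its pullbacks are $\mathcal{N}$-preadhesive. Unions. $(\mathsf{Sub}(X),\le)$ is the poset of subobjects of $X$ (isomorphism classes $[m]$ of monos into $X$, ordered by factorization). A mono $u:U\to X$ is an $\mathcal{M},\mathcal{N}$-union if there are $m\in\mathcal{M}$ and $n\in\mathcal{M}\cap\mathcal{N}$ with codomain $X$ such that $[u]=[m]\vee[n]$ in $(\mathsf{Sub}(X),\le)$. $\mathcal{M}$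 is closed under $\mathcal{M},\mathcal{N}$-unions if it contains all such monos. A split monomorphism is an arrow having a left inverse. -}

module Defs where

open import Level using (Level; _⊔_) renaming (suc to lsuc)
open import Data.Product using (_×_; _,_; proj₁; proj₂; Σ-syntax; ∃!)
open import Function.Bundles using (_⇔_)
open import Relation.Binary.Bundles using (Poset; Setoid)
open import Relation.Binary.Structures using (IsEquivalence)
import Relation.Binary.Reasoning.Setoid as SetoidReasoning

-- Hom-sets are setoids: arrows are compared up to _≈_, objects are never compared.
record Category (o ℓ e : Level) : Set (lsuc (o ⊔ ℓ ⊔ e)) where
  infix  4 _⇒_ _≈_
  infixr 9 _∘_
  field
    Obj       : Set o
    _⇒_       : Obj → Obj → Set ℓ
    _≈_       : ∀ {A B} → A ⇒ B → A ⇒ B → Set e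
    id        : ∀ {A} → A ⇒ A
    _∘_       : ∀ {A B C} → B ⇒ C → A ⇒ B → A ⇒ C
    equiv     : ∀ {A B} → IsEquivalence (_≈_ {A} {B})
    assoc     : ∀ {A B C D} {f : A ⇒ B} {g : B ⇒ C} {h : C ⇒ D} →
                (h ∘ g) ∘ f ≈ h ∘ (g ∘ f)
    identityˡ : ∀ {A B} {f : A ⇒ B} → id ∘ f ≈ f
    identityʳ : ∀ {A B} {f : A ⇒ B} → f ∘ id ≈ f
    ∘-resp-≈  : ∀ {A B C} {f h : B ⇒ C} {g i : A ⇒ B} →
                f ≈ h → g ≈ i → f ∘ g ≈ h ∘ i

  module Equiv {A B : Obj} = IsEquivalence (equiv {A} {B})

  hom-setoid : Obj → Obj → Setoid ℓ e
  hom-setoid A B = record { Carrier = A ⇒ B ; _≈_ = _≈_ ; isEquivalence = equiv }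

module _ {c ℓ₁ ℓ₂ : Level} (P : Poset c ℓ₁ ℓ₂) where
  open Poset P

  -- z = x ∨ y; the library's Supremum asks for a total join operation, whereas
  -- here individual joins may fail to exist.
  IsJoin : Carrier → Carrier → Carrier → Set (c ⊔ ℓ₂)
  IsJoin x y z = x ≤ z × y ≤ z × (∀ w → x ≤ w → y ≤ w → z ≤ w)

module Adhesivity {o ℓ e : Level} (𝐗 : Category o ℓ e) where
  open Category 𝐗 public

  record ArrowClass (p : Level) : Set (o ⊔ ℓ ⊔ e ⊔ lsuc p) where
    field
      member : ∀ {A B} → A ⇒ B → Set p
      resp   : ∀ {A B} {f g : A ⇒ B} → f ≈ g → member f → member g

  infix 4 _∈_

  _∈_ : ∀ {p} {A B : Obj} → A ⇒ B → ArrowClass p → Set p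
  f ∈ 𝓐 = ArrowClass.member 𝓐 f

  Mono : ∀ {A B} → A ⇒ B → Set (o ⊔ ℓ ⊔ e)
  Mono {A} m = ∀ {C} (g h : C ⇒ A) → m ∘ g ≈ m ∘ h → g ≈ h

  SplitMono : ∀ {A B} → A ⇒ B → Set (ℓ ⊔ e)
  SplitMono {A} {B} s = Σ[ r ∈ B ⇒ A ] r ∘ s ≈ id

  record IsIso {A B : Obj} (f : A ⇒ B) : Set (ℓ ⊔ e) where
    field
      inv  : B ⇒ A
      isoˡ : inv ∘ f ≈ id
      isoʳ : f ∘ inv ≈ id

  -- In every square predicate below, the arguments f m n g (in this order) are laid out as
  --
  --     A --f--> B
  --     |        |
  --     m        n
  --     v        v
  --     C --g--> D

  record IsPullback {A B C D : Obj} (f : A ⇒ B) (m : A ⇒ C) (n : B ⇒ D) (g : C ⇒ D)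
         : Set (o ⊔ ℓ ⊔ e) where
    field
      commute   : n ∘ f ≈ g ∘ m
      universal : ∀ {Q} (h : Q ⇒ B) (k : Q ⇒ C) → n ∘ h ≈ g ∘ k →
                  ∃! _≈_ λ (u : Q ⇒ A) → (f ∘ u ≈ h) × (m ∘ u ≈ k)

  record IsPushout {A B C D : Obj} (f : A ⇒ B) (m : A ⇒ C) (n : B ⇒ D) (g : C ⇒ D)
         : Set (o ⊔ ℓ ⊔ e) where
    field
      commute   : n ∘ f ≈ g ∘ m
      universal : ∀ {Q} (h : B ⇒ Q) (k : C ⇒ Q) → h ∘ f ≈ k ∘ m →
                  ∃! _≈_ λ (u : D ⇒ Q) → (u ∘ n ≈ h) × (u ∘ g ≈ k)

  HasPullback : ∀ {B C D} → B ⇒ D → C ⇒ D → Set (o ⊔ ℓ ⊔ e)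
  HasPullback {B} {C} n g =
    Σ[ A ∈ Obj ] Σ[ f ∈ A ⇒ B ] Σ[ m ∈ A ⇒ C ] IsPullback f m n g

  HasPushout : ∀ {A B C} → A ⇒ B → A ⇒ C → Set (o ⊔ ℓ ⊔ e)
  HasPushout {A} {B} {C} f m =
    Σ[ D ∈ Obj ] Σ[ n ∈ B ⇒ D ] Σ[ g ∈ C ⇒ D ] IsPushout f m n g

  ContainsIsos : ∀ {p} → ArrowClass p → Set (o ⊔ ℓ ⊔ e ⊔ p)
  ContainsIsos 𝓐 = ∀ {A B} (f : A ⇒ B) → IsIso f → f ∈ 𝓐

  ClosedUnderComposition : ∀ {p} → ArrowClass p → Set (o ⊔ ℓ ⊔ p)
  ClosedUnderComposition 𝓐 =
    ∀ {A B C} (f : A ⇒ B) (g : B ⇒ C) → f ∈ 𝓐 → g ∈ 𝓐 → g ∘ f ∈ 𝓐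

  -- 𝓐 is closed under 𝓑-decomposition.
  ClosedUnderDecomposition : ∀ {p q} → ArrowClass p → ArrowClass q → Set (o ⊔ ℓ ⊔ p ⊔ q)
  ClosedUnderDecomposition 𝓐 𝓑 =
    ∀ {A B C} (f : A ⇒ B) (g : B ⇒ C) → g ∘ f ∈ 𝓐 → g ∈ 𝓑 → f ∈ 𝓐

  StableUnderPullbacks : ∀ {p} → ArrowClass p → Set (o ⊔ ℓ ⊔ e ⊔ p)
  StableUnderPullbacks 𝓐 =
    ∀ {A B C D} (f : A ⇒ B) (m : A ⇒ C) (n : B ⇒ D) (g : C ⇒ D) →
    IsPullback f m n g → n ∈ 𝓐 → m ∈ 𝓐

  StableUnderPushouts : ∀ {p} → ArrowClass p → Set (o ⊔ ℓ ⊔ e ⊔ p)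
  StableUnderPushouts 𝓐 =
    ∀ {A B C D} (f : A ⇒ B) (m : A ⇒ C) (n : B ⇒ D) (g : C ⇒ D) →
    IsPushout f m n g → m ∈ 𝓐 → n ∈ 𝓐

  record IsPreadhesiveStructure {p q} (𝓜 : ArrowClass p) (𝓝 : ArrowClass q)
         : Set (o ⊔ ℓ ⊔ e ⊔ p ⊔ q) where
    field
      𝓜-mono            : ∀ {A B} (m : A ⇒ B) → m ∈ 𝓜 → Mono m
      𝓜-isos            : ContainsIsos 𝓜
      𝓝-isos            : ContainsIsos 𝓝
      𝓜-composition     : ClosedUnderComposition 𝓜
      𝓝-composition     : ClosedUnderComposition 𝓝
      𝓜-decomposition   : ClosedUnderDecomposition 𝓜 𝓜
      𝓝-decomposition   : ClosedUnderDecomposition 𝓝 𝓝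
      𝓝-𝓜-decomposition : ClosedUnderDecomposition 𝓝 𝓜
      𝓜-pullbacks       : StableUnderPullbacks 𝓜
      𝓝-pullbacks       : StableUnderPullbacks 𝓝
      𝓜-pushouts        : StableUnderPushouts 𝓜
      𝓝-pushouts        : StableUnderPushouts 𝓝

  -- Commutative cubes over a given bottom square g m n f; commutativity of the
  -- bottom face itself is part of the pushout hypothesis wherever cubes are used.
  record CubeOver {A B C D : Obj} (g : A ⇒ B) (m : A ⇒ C) (n : B ⇒ D) (f : C ⇒ D)
         : Set (o ⊔ ℓ ⊔ e) where
    field
      {A′ B′ C′ D′} : Obj
      g′ : A′ ⇒ B′
      m′ : A′ ⇒ C′
      n′ : B′ ⇒ D′
      f′ : C′ ⇒ D′
      a  : A′ ⇒ A
      b  : B′ ⇒ B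
      c  : C′ ⇒ C
      d  : D′ ⇒ D
      top-commute : n′ ∘ g′ ≈ f′ ∘ m′
      ab-commute  : b ∘ g′ ≈ g ∘ a
      ac-commute  : c ∘ m′ ≈ m ∘ a
      bd-commute  : d ∘ n′ ≈ n ∘ b
      cd-commute  : d ∘ f′ ≈ f ∘ c

    aFacesArePullbacks : Set (o ⊔ ℓ ⊔ e)
    aFacesArePullbacks = IsPullback g′ a b g × IsPullback m′ a c m

    dFacesArePullbacks : Set (o ⊔ ℓ ⊔ e)
    dFacesArePullbacks = IsPullback n′ b d n × IsPullback f′ c d f

    topIsPushout : Set (o ⊔ ℓ ⊔ e)
    topIsPushout = IsPushout g′ m′ n′ f′

  record IsVanKampen {A B C D : Obj} (g : A ⇒ B) (m : A ⇒ C) (n : B ⇒ D) (f : C ⇒ D)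
         : Set (o ⊔ ℓ ⊔ e) where
    field
      isPushout : IsPushout g m n f
      vanKampen : (κ : CubeOver g m n f) → let open CubeOver κ in
                  aFacesArePullbacks → topIsPushout ⇔ dFacesArePullbacks

  record IsStablePushout {A B C D : Obj} (g : A ⇒ B) (m : A ⇒ C) (n : B ⇒ D) (f : C ⇒ D)
         : Set (o ⊔ ℓ ⊔ e) where
    field
      isPushout : IsPushout g m n f
      stable    : (κ : CubeOver g m n f) → let open CubeOver κ in
                  aFacesArePullbacks → dFacesArePullbacks → topIsPushout

  record IsAdhesive {p q} (𝓜 : ArrowClass p) (𝓝 : ArrowClass q)
         : Set (o ⊔ ℓ ⊔ e ⊔ p ⊔ q) where
    field
      preadhesive : IsPreadhesiveStructure 𝓜 𝓝
      𝓜-pullback  : ∀ {B C D} (m : B ⇒ D) (g : C ⇒ D) → m ∈ 𝓜 → HasPullback m g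
      𝓜𝓝-pushout  : ∀ {X Y Z} (m : X ⇒ Y) (n : X ⇒ Z) → m ∈ 𝓜 → n ∈ 𝓝 → HasPushout n m
      𝓜𝓝-vanKampen : ∀ {X Y Z W} (m : X ⇒ Y) (n : X ⇒ Z) (i : Z ⇒ W) (j : Y ⇒ W) →
                      m ∈ 𝓜 → n ∈ 𝓝 → IsPushout n m i j → IsVanKampen n m i j

  IsPreadhesiveArrow : ∀ {q} → ArrowClass q → ∀ {X Y} → X ⇒ Y → Set (o ⊔ ℓ ⊔ e ⊔ q)
  IsPreadhesiveArrow 𝓝 {X} {Y} m =
    ∀ {Z} (n : X ⇒ Z) → n ∈ 𝓝 →
    Σ[ W ∈ Obj ] Σ[ i ∈ Z ⇒ W ] Σ[ j ∈ Y ⇒ W ]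
      IsStablePushout n m i j × IsPullback n m i j

  IsAdhesiveArrow : ∀ {q} → ArrowClass q → ∀ {X Y} → X ⇒ Y → Set (o ⊔ ℓ ⊔ e ⊔ q)
  IsAdhesiveArrow 𝓝 {X} {Y} m =
    ∀ {X′ Y′} (f : X′ ⇒ X) (m′ : X′ ⇒ Y′) (g : Y′ ⇒ Y) →
    IsPullback f m′ m g → IsPreadhesiveArrow 𝓝 m′

  record MonoInto (X : Obj) : Set (o ⊔ ℓ ⊔ e) where
    field
      {dom} : Obj
      arr   : dom ⇒ X
      mono  : Mono arr

  open MonoInto

  infix 4 _≤ₛ_ _≅ₛ_

  _≤ₛ_ : ∀ {X} → MonoInto X → MonoInto X → Set (ℓ ⊔ e)
  s ≤ₛ t = Σ[ h ∈ dom s ⇒ dom t ] arr t ∘ h ≈ arr s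

  _≅ₛ_ : ∀ {X} → MonoInto X → MonoInto X → Set (ℓ ⊔ e)
  s ≅ₛ t = Σ[ φ ∈ dom s ⇒ dom t ] IsIso φ × arr t ∘ φ ≈ arr s

  private
    ≤ₛ-refl : ∀ {X} {s : MonoInto X} → s ≤ₛ s
    ≤ₛ-refl = id , identityʳ

    ≤ₛ-trans : ∀ {X} {s t u : MonoInto X} → s ≤ₛ t → t ≤ₛ u → s ≤ₛ u
    ≤ₛ-trans (h , p) (k , q) =
      k ∘ h , Equiv.trans (Equiv.sym assoc) (Equiv.trans (∘-resp-≈ q Equiv.refl) p)

    ≅ₛ⇒≤ₛ : ∀ {X} {s t : MonoInto X} → s ≅ₛ t → s ≤ₛ t
    ≅ₛ⇒≤ₛ (φ , _ , p) = φ , p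

    ≅ₛ⇒≥ₛ : ∀ {X} {s t : MonoInto X} → s ≅ₛ t → t ≤ₛ s
    ≅ₛ⇒≥ₛ {X} {s} {t} (φ , i , p) = inv , (begin
      arr s ∘ inv        ≈⟨ ∘-resp-≈ (Equiv.sym p) Equiv.refl ⟩
      (arr t ∘ φ) ∘ inv  ≈⟨ assoc ⟩
      arr t ∘ (φ ∘ inv)  ≈⟨ ∘-resp-≈ Equiv.refl isoʳ ⟩
      arr t ∘ id         ≈⟨ identityʳ ⟩
      arr t              ∎)
      where
        open IsIso i
        open SetoidReasoning (hom-setoid (dom t) X)

    ≤ₛ-loop : ∀ {X} (s t : MonoInto X) (p : s ≤ₛ t) (q : t ≤ₛ s) →
              proj₁ q ∘ proj₁ p ≈ id
    ≤ₛ-loop s t p q =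
      mono s _ _ (Equiv.trans (proj₂ (≤ₛ-trans {s = s} {t} {s} p q)) (Equiv.sym identityʳ))

    ≤ₛ-antisym : ∀ {X} {s t : MonoInto X} → s ≤ₛ t → t ≤ₛ s → s ≅ₛ t
    ≤ₛ-antisym {s = s} {t} p q = proj₁ p , record
      { inv  = proj₁ q
      ; isoˡ = ≤ₛ-loop s t p q
      ; isoʳ = ≤ₛ-loop t s q p
      } , proj₂ p

  -- The quotient by isomorphism is carried by the poset's equality _≅ₛ_.
  Sub : Obj → Poset (o ⊔ ℓ ⊔ e) (ℓ ⊔ e) (ℓ ⊔ e)
  Sub X = record
    { Carrier = MonoInto X
    ; _≈_ = _≅ₛ_
    ; _≤_ = _≤ₛ_
    ; isPartialOrder = record
      { isPreorder = record
        { isEquivalence = record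
          { refl  = λ {s} → ≤ₛ-antisym {s = s} {s} (≤ₛ-refl {s = s}) (≤ₛ-refl {s = s})
          ; sym   = λ {s} {t} p → ≤ₛ-antisym {s = t} {s} (≅ₛ⇒≥ₛ {s = s} {t} p) (≅ₛ⇒≤ₛ {s = s} {t} p)
          ; trans = λ {s} {t} {u} p q → ≤ₛ-antisym {s = s} {u}
              (≤ₛ-trans {s = s} {t} {u} (≅ₛ⇒≤ₛ {s = s} {t} p) (≅ₛ⇒≤ₛ {s = t} {u} q))
              (≤ₛ-trans {s = u} {t} {s} (≅ₛ⇒≥ₛ {s = t} {u} q) (≅ₛ⇒≥ₛ {s = s} {t} p))
          }
        ; reflexive = λ {s} {t} → ≅ₛ⇒≤ₛ {s = s} {t}
        ; trans     = λ {s} {t} {u} → ≤ₛ-trans {s = s} {t} {u}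
        }
      ; antisym = λ {s} {t} → ≤ₛ-antisym {s = s} {t}
      }
    }

  IsUnion : ∀ {p q} → ArrowClass p → ArrowClass q →
            ∀ {X} → MonoInto X → Set (o ⊔ ℓ ⊔ e ⊔ p ⊔ q)
  IsUnion 𝓜 𝓝 {X} u =
    Σ[ m ∈ MonoInto X ] Σ[ n ∈ MonoInto X ]
      arr m ∈ 𝓜 × (arr n ∈ 𝓜 × arr n ∈ 𝓝) × IsJoin (Sub X) m n u

  ClosedUnderUnions : ∀ {p q} → ArrowClass p → ArrowClass q → Set (o ⊔ ℓ ⊔ e ⊔ p ⊔ q)
  ClosedUnderUnions 𝓜 𝓝 = ∀ {X} (u : MonoInto X) → IsUnion 𝓜 𝓝 u → arr u ∈ 𝓜

{-# OPTIONS --safe #-}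
module Submission where

-- Let i ∘ n = j ∘ m be the pushout of m : X → Y in 𝓜 along n : X → Z in 𝓝, with corner W, and
-- mark the top of a cube over it by primes. The square is stable and a pullback, so it remains to
-- see that the front faces of a cube with a pushout on top are pullbacks. For the face over
-- i ∈ 𝓜, pull the top square back along the mono Z ×_W W′ → W′; it becomes a pushout of an
-- identity. As j need not be mono, the face over j needs the kernel pairs X₂ of n and Y₂ of j.
-- The key point is that m, the induced k : X₂ → Y₂ and the two diagonals form a pushout square.
-- Indeed the diagonal of X is split, so its pushout along m exists; it is the union of Y and X₂
-- in Y₂, so its comparison u with Y₂ lies in 𝓜; some 𝓜,𝓝-pushout of u is an identity, which
-- makes u invertible. Pulling back this square along Y′ ×_W Y → Y₂ and the top square along
-- Q = Y ×_W W′ → W′, and pasting the results, displays Y′ → Q as a pushout of an identity.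

open import Defs
open import Level using (Level)
open import Data.Product using (_×_; _,_; proj₁; proj₂; Σ-syntax)
open import Function.Bundles using (mk⇔)
import Relation.Binary.Reasoning.Setoid as SetoidReasoning

-- Equational reasoning in hom-setoids

module HomReasoning {o ℓ e : Level} (𝐗 : Category o ℓ e) where
  open Category 𝐗
  open module Reasoning {A B : Obj} = SetoidReasoning (hom-setoid A B) public
  open module EquivHom {A B : Obj} = Equiv {A} {B} public using (refl; sym; trans)

  private variable
    A B C D E : Obj
    f g h k s t : A ⇒ B

  infixr 9 _∘ˡ_ _∘ʳ_

  _∘ˡ_ : (f : B ⇒ C) → g ≈ h → f ∘ g ≈ f ∘ h
  f ∘ˡ p = ∘-resp-≈ refl p

  _∘ʳ_ : g ≈ h → (f : A ⇒ B) → g ∘ f ≈ h ∘ f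
  p ∘ʳ f = ∘-resp-≈ p refl

  pullˡ : f ∘ g ≈ h → f ∘ (g ∘ k) ≈ h ∘ k
  pullˡ p = trans (sym assoc) (p ∘ʳ _)

  pullʳ : f ∘ g ≈ h → (k ∘ f) ∘ g ≈ k ∘ h
  pullʳ p = trans assoc (_ ∘ˡ p)

  extendˡ : f ∘ g ≈ s ∘ t → f ∘ (g ∘ k) ≈ s ∘ (t ∘ k)
  extendˡ p = trans (pullˡ p) assoc

  cancelˡ : f ∘ g ≈ id → f ∘ (g ∘ k) ≈ k
  cancelˡ p = trans (pullˡ p) identityˡ

  id-comm : f ∘ id ≈ id ∘ f
  id-comm = trans identityʳ (sym identityˡ)

-- Pullback squares: pasting, cancellation and monomorphisms

module PullbackProperties {o ℓ e : Level} (𝐗 : Category o ℓ e) where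
  open Adhesivity 𝐗
  open HomReasoning 𝐗

  private variable
    A B C D E F : Obj
    f g m n s t : A ⇒ B

  pullback-swap : IsPullback f m n g → IsPullback m f g n
  pullback-swap P = record
    { commute   = sym commute
    ; universal = λ h k eq → let u , (p , q) , unique = universal k h (sym eq) in
        u , (q , p) , λ (q′ , p′) → unique (p′ , q′)
    }
    where open IsPullback P

  pullback-jointlyMonic : IsPullback f m n g → f ∘ s ≈ f ∘ t → m ∘ s ≈ m ∘ t → s ≈ t
  pullback-jointlyMonic {t = t} P p q =
    let _ , _ , unique = universal _ _ (extendˡ {k = t} commute) in
    trans (sym (unique (p , q))) (unique (refl , refl))
    where open IsPullback P

  -- The outer edges are variables `s` and `t` with equations, not literal composites, so that the
  -- pasted square can carry any arrows equal to the composites.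
  pullback-paste : {f : A ⇒ B} {m : A ⇒ C} {n : B ⇒ D} {g : C ⇒ D}
                   {f′ : B ⇒ E} {p : E ⇒ F} {g′ : D ⇒ F} {s : A ⇒ E} {t : C ⇒ F} →
                   IsPullback f m n g → IsPullback f′ n p g′ →
                   f′ ∘ f ≈ s → g′ ∘ g ≈ t → IsPullback s m p t
  pullback-paste {f = f} {m} {n} {g} {f′} {p} {g′} {s} {t} L R α β = record
    { commute = begin
        p ∘ s         ≈⟨ p ∘ˡ α ⟨
        p ∘ (f′ ∘ f)  ≈⟨ extendˡ R.commute ⟩
        g′ ∘ (n ∘ f)  ≈⟨ g′ ∘ˡ L.commute ⟩
        g′ ∘ (g ∘ m)  ≈⟨ pullˡ β ⟩
        t ∘ m         ∎
    ; universal = λ h k eq →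
        let v , (f′v , nv) , v! = R.universal h (g ∘ k) (trans eq (sym (pullˡ β)))
            u , (fu , mu) , u! = L.universal v k nv
        in u , (trans (sym (pullˡ α)) (trans (f′ ∘ˡ fu) f′v) , mu) , λ (sy , my) →
           u! (sym (v! (trans (pullˡ α) sy , trans (extendˡ L.commute) (g ∘ˡ my))) , my)
    }
    where
      module L = IsPullback L
      module R = IsPullback R

  pullback-unpaste : {f : A ⇒ B} {m : A ⇒ C} {n : B ⇒ D} {g : C ⇒ D}
                     {f′ : B ⇒ E} {p : E ⇒ F} {g′ : D ⇒ F} {s : A ⇒ E} {t : C ⇒ F} →
                     IsPullback f′ n p g′ → IsPullback s m p t →
                     f′ ∘ f ≈ s → g′ ∘ g ≈ t → n ∘ f ≈ g ∘ m → IsPullback f m n g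
  pullback-unpaste {f = f} {m} {n} {g} {f′} {p} {g′} {s} {t} R T α β γ = record
    { commute = γ
    ; universal = λ h k eq →
        let u , (su , mu) , u! = T.universal (f′ ∘ h) k (begin
              p ∘ (f′ ∘ h)  ≈⟨ extendˡ R.commute ⟩
              g′ ∘ (n ∘ h)  ≈⟨ g′ ∘ˡ eq ⟩
              g′ ∘ (g ∘ k)  ≈⟨ pullˡ β ⟩
              t ∘ k         ∎)
        in u
         , ( pullback-jointlyMonic R (trans (pullˡ α) su)
               (trans (extendˡ γ) (trans (g ∘ˡ mu) (sym eq)))
           , mu)
         , λ (fy , my) → u! (trans (sym (pullˡ α)) (f′ ∘ˡ fy) , my)
    }
    where
      module R = IsPullback R
      module T = IsPullback T

  pullback-id : IsPullback f id id f
  pullback-id {f = f} = record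
    { commute   = sym id-comm
    ; universal = λ h k eq →
        k , (trans (sym eq) identityˡ , identityˡ) , λ (_ , q) → trans (sym q) identityˡ
    }

  pullback-along-id : IsPullback f m id g → IsIso m
  pullback-along-id {g = g} P =
    let u , (fu , mu) , _ = universal g id (sym id-comm) in record
    { inv  = u
    ; isoˡ = pullback-jointlyMonic P
               (trans (pullˡ fu) (trans (sym commute) (sym id-comm)))
               (trans (pullˡ mu) (sym id-comm))
    ; isoʳ = mu
    }
    where open IsPullback P

  -- Both front faces are obtained this way: `u` is the comparison with a chosen pullback, and only
  -- its invertibility has to be shown.
  pullback-precompose-iso : {f : B ⇒ D} {m : B ⇒ C} {n : D ⇒ E} {g : C ⇒ E}
                            {s : A ⇒ D} {t : A ⇒ C} {u : A ⇒ B} →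
                            IsIso u → IsPullback f m n g →
                            f ∘ u ≈ s → m ∘ u ≈ t → IsPullback s t n g
  pullback-precompose-iso {f = f} {m} {n} {g} {s} {t} {u} I P α β = record
    { commute   = trans (n ∘ˡ sym α) (trans (extendˡ commute) (g ∘ˡ β))
    ; universal = λ h k eq →
        let v , (fv , mv) , v! = universal h k eq in
        inv ∘ v
        , ( trans (sym (pullˡ α)) (trans (f ∘ˡ cancelˡ isoʳ) fv)
          , trans (sym (pullˡ β)) (trans (m ∘ˡ cancelˡ isoʳ) mv))
        , λ (sy , ty) →
            trans (inv ∘ˡ v! (trans (pullˡ α) sy , trans (pullˡ β) ty)) (cancelˡ isoˡ)
    }
    where
      open IsPullback P
      open IsIso I

  pullback-postcompose-mono : {n : B ⇒ D} {g : C ⇒ D} {s : B ⇒ E} {t : C ⇒ E} {u : D ⇒ E} →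
                              Mono u → IsPullback f m n g →
                              u ∘ n ≈ s → u ∘ g ≈ t → IsPullback f m s t
  pullback-postcompose-mono {u = u} mono P α β = record
    { commute   = trans (sym (pullˡ α)) (trans (u ∘ˡ commute) (pullˡ β))
    ; universal = λ h k eq →
        universal h k (mono _ _ (trans (pullˡ α) (trans eq (sym (pullˡ β)))))
    }
    where open IsPullback P

  pullback-cancel : {n : B ⇒ D} {g : C ⇒ D} {s : B ⇒ E} {t : C ⇒ E} {u : D ⇒ E} →
                    n ∘ f ≈ g ∘ m → IsPullback f m s t →
                    u ∘ n ≈ s → u ∘ g ≈ t → IsPullback f m n g
  pullback-cancel {u = u} γ P α β = record
    { commute   = γ
    ; universal = λ h k eq →
        universal h k (trans (sym (pullˡ α)) (trans (u ∘ˡ eq) (pullˡ β)))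
    }
    where open IsPullback P

  pullback-of-mono : IsPullback f m n g → Mono n → Mono m
  pullback-of-mono {g = g} P mono s t eq =
    pullback-jointlyMonic P
      (mono _ _ (trans (extendˡ commute) (trans (g ∘ˡ eq) (sym (extendˡ commute))))) eq
    where open IsPullback P

  pullback-of-factor : Mono m → m ∘ f ≈ g → IsPullback f id m g
  pullback-of-factor mono α = record
    { commute   = trans α (sym identityʳ)
    ; universal = λ h k eq →
        k , (mono _ _ (trans (pullˡ α) (sym eq)) , identityˡ)
        , λ (_ , q) → trans (sym q) identityˡ
    }

  mono-resp : f ≈ g → Mono f → Mono g
  mono-resp p mono s t eq = mono s t (trans (p ∘ʳ s) (trans eq (sym (p ∘ʳ t))))

  splitMono-mono : SplitMono f → Mono f
  splitMono-mono (r , rf) s t eq =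
    trans (sym (cancelˡ rf)) (trans (r ∘ˡ eq) (cancelˡ rf))

-- Pushout squares by duality

op : {o ℓ e : Level} → Category o ℓ e → Category o ℓ e
op 𝐗 = record
  { Obj       = Obj
  ; _⇒_       = λ A B → B ⇒ A
  ; _≈_       = _≈_
  ; id        = id
  ; _∘_       = λ g f → f ∘ g
  ; equiv     = equiv
  ; assoc     = Equiv.sym assoc
  ; identityˡ = identityʳ
  ; identityʳ = identityˡ
  ; ∘-resp-≈  = λ p q → ∘-resp-≈ q p
  }
  where open Category 𝐗

module PushoutProperties {o ℓ e : Level} (𝐗 : Category o ℓ e) where
  open Adhesivity 𝐗
  open HomReasoning 𝐗
  private
    module Op where
      open Adhesivity (op 𝐗) public using (IsPullback; IsIso)
      open PullbackProperties (op 𝐗) public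

  private variable
    A B C D E F : Obj
    f g m n s t : A ⇒ B

  -- Read from its last corner in the opposite category, the square has the same two fields after
  -- unfolding, so dualizing costs no computation.
  fromPushout : {f : A ⇒ B} {m : A ⇒ C} {n : B ⇒ D} {g : C ⇒ D} →
                IsPushout f m n g → Op.IsPullback n g f m
  fromPushout P = record { commute = commute ; universal = universal }
    where open IsPushout P

  toPushout : {f : A ⇒ B} {m : A ⇒ C} {n : B ⇒ D} {g : C ⇒ D} →
              Op.IsPullback n g f m → IsPushout f m n g
  toPushout P = record { commute = commute ; universal = universal }
    where open Adhesivity.IsPullback P

  pushout-swap : IsPushout f m n g → IsPushout m f g n
  pushout-swap P = toPushout (Op.pullback-swap (fromPushout P))

  pushout-jointlyEpic : IsPushout f m n g → s ∘ n ≈ t ∘ n → s ∘ g ≈ t ∘ g → s ≈ t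
  pushout-jointlyEpic P = Op.pullback-jointlyMonic (fromPushout P)

  -- Dualizing makes the shared vertical edge `n` horizontal and exchanges the two squares; the
  -- swaps make it vertical again.
  pushout-unpaste : {f : A ⇒ B} {m : A ⇒ C} {n : B ⇒ D} {g : C ⇒ D}
                    {f′ : B ⇒ E} {p : E ⇒ F} {g′ : D ⇒ F} {s : A ⇒ E} {t : C ⇒ F} →
                    IsPushout f m n g → IsPushout s m p t →
                    f′ ∘ f ≈ s → g′ ∘ g ≈ t → p ∘ f′ ≈ g′ ∘ n → IsPushout f′ n p g′
  pushout-unpaste L T α β γ = toPushout (Op.pullback-swap
    (Op.pullback-unpaste (Op.pullback-swap (fromPushout L)) (Op.pullback-swap (fromPushout T))
       β α (sym γ)))

  pushout-paste : {f : A ⇒ B} {m : A ⇒ C} {n : B ⇒ D} {g : C ⇒ D}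
                  {f′ : B ⇒ E} {p : E ⇒ F} {g′ : D ⇒ F} {s : A ⇒ E} {t : C ⇒ F} →
                  IsPushout f m n g → IsPushout f′ n p g′ →
                  f′ ∘ f ≈ s → g′ ∘ g ≈ t → IsPushout s m p t
  pushout-paste L R α β = toPushout (Op.pullback-swap
    (Op.pullback-paste (Op.pullback-swap (fromPushout R)) (Op.pullback-swap (fromPushout L)) β α))

  pushout-id : IsPushout id f f id
  pushout-id = toPushout Op.pullback-id

  pushout-along-id : IsPushout id m n g → IsIso g
  pushout-along-id P = record { inv = inv ; isoˡ = isoʳ ; isoʳ = isoˡ }
    where open Adhesivity.IsIso (Op.pullback-along-id (fromPushout P))

  pushout-postcompose-iso : {n : B ⇒ D} {g : C ⇒ D} {s : B ⇒ E} {t : C ⇒ E} {u : D ⇒ E} →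
                            IsIso u → IsPushout f m n g →
                            u ∘ n ≈ s → u ∘ g ≈ t → IsPushout f m s t
  pushout-postcompose-iso I P α β =
    toPushout (Op.pullback-precompose-iso
      (record { inv = inv ; isoˡ = isoʳ ; isoʳ = isoˡ }) (fromPushout P) α β)
    where open IsIso I

  -- The composite `φ ∘ ψ` fixes the jointly epic legs `n` and `g`. The left inverse is recorded
  -- because it makes `ψ` monic, which is what transfers stability.
  pushout-comparison : {n : B ⇒ D} {g : C ⇒ D} {n₀ : B ⇒ E} {g₀ : C ⇒ E} →
                       IsPushout f m n g → IsPushout f m n₀ g₀ →
                       Σ[ ψ ∈ D ⇒ E ] (SplitMono ψ × ψ ∘ n ≈ n₀ × ψ ∘ g ≈ g₀)
  pushout-comparison P P₀ =
    let ψ , (ψn , ψg) , _ = P.universal _ _ P₀.commute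
        φ , (φn , φg) , _ = P₀.universal _ _ P.commute
    in ψ
     , (φ , pushout-jointlyEpic P
              (trans (pullʳ ψn) (trans φn (sym identityˡ)))
              (trans (pullʳ ψg) (trans φg (sym identityˡ))))
     , ψn , ψg
    where
      module P = IsPushout P
      module P₀ = IsPushout P₀

-- Stable pushouts and their base changes

module StabilityProperties {o ℓ e : Level} (𝐗 : Category o ℓ e) where
  open Adhesivity 𝐗
  open HomReasoning 𝐗
  open PullbackProperties 𝐗
  open PushoutProperties 𝐗

  private variable
    A B C D E T W : Obj
    f g m n : A ⇒ B

  cube-swap : CubeOver g m n f → CubeOver m g f n
  cube-swap κ = record
    { g′ = m′ ; m′ = g′ ; n′ = f′ ; f′ = n′ ; a = a ; b = c ; c = b ; d = d
    ; top-commute = sym top-commute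
    ; ab-commute  = ac-commute
    ; ac-commute  = ab-commute
    ; bd-commute  = cd-commute
    ; cd-commute  = bd-commute
    }
    where open CubeOver κ

  -- The faces over `g` and `n` paste to a pullback over `n ∘ g`, hence over `f ∘ m`, and the face
  -- over `f` cancels from it.
  cube-fourthPullback : (κ : CubeOver g m n f) → let open CubeOver κ in
                        n ∘ g ≈ f ∘ m → IsPullback g′ a b g → dFacesArePullbacks →
                        IsPullback m′ a c m
  cube-fourthPullback κ bottom-commute P (Pn , Pf) =
    pullback-unpaste Pf (pullback-paste P Pn refl refl)
      (sym top-commute) (sym bottom-commute) ac-commute
    where open CubeOver κ

  stablePushout-swap : IsStablePushout g m n f → IsStablePushout m g f n
  stablePushout-swap S = record
    { isPushout = pushout-swap isPushout
    ; stable    = λ κ (P , Q) (R , T) → pushout-swap (stable (cube-swap κ) (Q , P) (T , R))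
    }
    where open IsStablePushout S

  -- Composing `d` with `ψ` turns a cube over the first square into one over the second. Its front
  -- faces remain pullbacks because `ψ` is monic.
  stablePushout-cancelMono : {n : B ⇒ D} {f : C ⇒ D} {n₀ : B ⇒ W} {f₀ : C ⇒ W} {ψ : D ⇒ W} →
                             Mono ψ → ψ ∘ n ≈ n₀ → ψ ∘ f ≈ f₀ → IsPushout g m n f →
                             IsStablePushout g m n₀ f₀ → IsStablePushout g m n f
  stablePushout-cancelMono {ψ = ψ} mono α β P S = record
    { isPushout = P
    ; stable    = λ κ as (Pn , Pf) → let open CubeOver κ in
        IsStablePushout.stable S
          (record
            { g′ = g′ ; m′ = m′ ; n′ = n′ ; f′ = f′ ; a = a ; b = b ; c = c ; d = ψ ∘ d
            ; top-commute = top-commute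
            ; ab-commute  = ab-commute
            ; ac-commute  = ac-commute
            ; bd-commute  = trans (pullʳ bd-commute) (pullˡ α)
            ; cd-commute  = trans (pullʳ cd-commute) (pullˡ β)
            })
          as
          (pullback-postcompose-mono mono Pn refl α , pullback-postcompose-mono mono Pf refl β)
    }

  -- The base change is along θ; p and q say that the sections Δ and δ pull back to sections
  -- over X′ and Y′.
  stablePushout-retract :
    {X Y X₂ Y₂ X′ Y′ S R : Obj}
    {Δ : X ⇒ X₂} {m : X ⇒ Y} {k : X₂ ⇒ Y₂} {δ : Y ⇒ Y₂} {p : X₂ ⇒ X} {q : Y₂ ⇒ Y}
    {m′ : X′ ⇒ Y′} {x : X′ ⇒ X} {y : Y′ ⇒ Y}
    {k′ : S ⇒ R} {p′ : S ⇒ X′} {q′ : R ⇒ Y′} {θ : R ⇒ Y₂} →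
    IsStablePushout Δ m k δ → p ∘ Δ ≈ id → q ∘ δ ≈ id → IsPullback k p q m →
    IsPullback m′ x y m → IsPullback k′ p′ q′ m′ → IsPullback θ q′ q y →
    Σ[ Δ′ ∈ X′ ⇒ S ] Σ[ δ′ ∈ Y′ ⇒ R ]
      (p′ ∘ Δ′ ≈ id × q′ ∘ δ′ ≈ id × θ ∘ δ′ ≈ δ ∘ y × IsPushout Δ′ m′ k′ δ′)
  stablePushout-retract {Δ = Δ} {m} {k} {δ} {p} {q} {m′} {x} {y} {k′} {p′} {q′} {θ}
                        St pΔ qδ Pk Pm Pk′ Pθ =
    let δ′ , (θδ′ , q′δ′) , _ =
          IsPullback.universal Pθ (δ ∘ y) id (trans (cancelˡ qδ) (sym identityʳ))
        Δ′ , (k′Δ′ , p′Δ′) , _ =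
          IsPullback.universal Pk′ (δ′ ∘ m′) id (trans (cancelˡ q′δ′) (sym identityʳ))
        ξ , (kξ , pξ) , _ = IsPullback.universal Pk (θ ∘ k′) (x ∘ p′) (begin
          q ∘ (θ ∘ k′)   ≈⟨ extendˡ (IsPullback.commute Pθ) ⟩
          y ∘ (q′ ∘ k′)  ≈⟨ y ∘ˡ IsPullback.commute Pk′ ⟩
          y ∘ (m′ ∘ p′)  ≈⟨ extendˡ (IsPullback.commute Pm) ⟩
          m ∘ (x ∘ p′)   ∎)
        ξΔ′ = pullback-jointlyMonic Pk
          (begin
            k ∘ (ξ ∘ Δ′)   ≈⟨ extendˡ kξ ⟩
            θ ∘ (k′ ∘ Δ′)  ≈⟨ θ ∘ˡ k′Δ′ ⟩
            θ ∘ (δ′ ∘ m′)  ≈⟨ extendˡ θδ′ ⟩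
            δ ∘ (y ∘ m′)   ≈⟨ δ ∘ˡ IsPullback.commute Pm ⟩
            δ ∘ (m ∘ x)    ≈⟨ extendˡ (IsPushout.commute isPushout) ⟨
            k ∘ (Δ ∘ x)    ∎)
          (trans (extendˡ pξ) (trans (x ∘ˡ p′Δ′) (trans identityʳ (sym (cancelˡ pΔ)))))
        κ = record
          { g′ = Δ′ ; m′ = m′ ; n′ = k′ ; f′ = δ′ ; a = x ; b = ξ ; c = y ; d = θ
          ; top-commute = k′Δ′
          ; ab-commute  = ξΔ′
          ; ac-commute  = IsPullback.commute Pm
          ; bd-commute  = sym kξ
          ; cd-commute  = θδ′
          }
        -- Pasting with the squares over `q` recognizes both front faces: over `δ` the composite is
        -- the trivial square on `y`, since `δ` and `δ′` are sections; over `k` it is `Pk′` followed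
        -- by `Pm`.
        Pδ′ = pullback-unpaste (pullback-swap Pθ) (pullback-swap pullback-id) q′δ′ qδ θδ′
        Pξ = pullback-swap (pullback-unpaste (pullback-swap Pk)
               (pullback-paste (pullback-swap Pk′) (pullback-swap Pm) refl refl)
               pξ (IsPullback.commute Pθ) kξ)
        PΔ′ = cube-fourthPullback (cube-swap κ) (sym (IsPushout.commute isPushout))
                Pm (Pδ′ , Pξ)
    in Δ′ , δ′ , p′Δ′ , q′δ′ , θδ′ , stable κ (PΔ′ , Pm) (Pξ , Pδ′)
    where open IsStablePushout St

  module _ (pullbacks : ∀ {B C D} (n : B ⇒ D) (g : C ⇒ D) → HasPullback n g) where

    -- By stability, `W` is the pushout of its parts lying over `B` and `C`, so two arrows out of
    -- `W` can be compared on these parts.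
    stablePushout-cover : {g : A ⇒ B} {m : A ⇒ C} {n : B ⇒ D} {f : C ⇒ D}
                          {x y : W ⇒ T} {d : W ⇒ D} →
                          IsStablePushout g m n f →
                          (∀ {V} (n′ : V ⇒ W) (b : V ⇒ B) → d ∘ n′ ≈ n ∘ b → x ∘ n′ ≈ y ∘ n′) →
                          (∀ {V} (f′ : V ⇒ W) (c : V ⇒ C) → d ∘ f′ ≈ f ∘ c → x ∘ f′ ≈ y ∘ f′) →
                          x ≈ y
    stablePushout-cover {g = g} {m} {n} {f} {d = d} S agreeⁿ agreeᶠ =
      let _ , n′ , b , Pn = pullbacks d n
          _ , f′ , c , Pf = pullbacks d f
          _ , g′ , a , Pg = pullbacks b g
          m′ , (f′m′ , cm′) , _ = IsPullback.universal Pf (n′ ∘ g′) (m ∘ a) (begin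
            d ∘ (n′ ∘ g′)  ≈⟨ extendˡ (IsPullback.commute Pn) ⟩
            n ∘ (b ∘ g′)   ≈⟨ n ∘ˡ IsPullback.commute Pg ⟩
            n ∘ (g ∘ a)    ≈⟨ extendˡ (IsPushout.commute isPushout) ⟩
            f ∘ (m ∘ a)    ∎)
          κ = record
            { g′ = g′ ; m′ = m′ ; n′ = n′ ; f′ = f′ ; a = a ; b = b ; c = c ; d = d
            ; top-commute = sym f′m′
            ; ab-commute  = IsPullback.commute Pg
            ; ac-commute  = cm′
            ; bd-commute  = IsPullback.commute Pn
            ; cd-commute  = IsPullback.commute Pf
            }
      in pushout-jointlyEpic
           (stable κ
             (Pg , cube-fourthPullback κ (IsPushout.commute isPushout) Pg (Pn , Pf)) (Pn , Pf))
           (agreeⁿ n′ b (IsPullback.commute Pn)) (agreeᶠ f′ c (IsPullback.commute Pf))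
      where open IsStablePushout S

    -- Cover `W` by means of `t`. Where `t` lands in `B`, cancel the mono `u ∘ n`. Where it lands in
    -- `C`, the two points meet in the intersection `A`, on which the legs agree.
    pushoutOfIntersection-leg : {f : A ⇒ B} {m : A ⇒ C} {n : B ⇒ D} {g : C ⇒ D} {u : D ⇒ E} →
                                IsStablePushout f m n g → Mono (u ∘ n) →
                                IsPullback f m (u ∘ n) (u ∘ g) →
                                (x : W ⇒ B) (t : W ⇒ D) → u ∘ (n ∘ x) ≈ u ∘ t → n ∘ x ≈ t
    pushoutOfIntersection-leg {f = f} {m} {n} {g} {u} S mono P x t eq =
      stablePushout-cover S
        (λ e y te → begin
          (n ∘ x) ∘ e  ≈⟨ assoc ⟩
          n ∘ (x ∘ e)  ≈⟨ n ∘ˡ mono _ _ (trans (meet e) (trans (u ∘ˡ te) (sym assoc))) ⟩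
          n ∘ y        ≈⟨ te ⟨
          t ∘ e        ∎)
        (λ e y te →
          let v , (fv , mv) , _ =
                IsPullback.universal P (x ∘ e) y (trans (meet e) (trans (u ∘ˡ te) (sym assoc)))
          in begin
            (n ∘ x) ∘ e  ≈⟨ pullʳ (sym fv) ⟩
            n ∘ (f ∘ v)  ≈⟨ extendˡ (IsPushout.commute isPushout) ⟩
            g ∘ (m ∘ v)  ≈⟨ g ∘ˡ mv ⟩
            g ∘ y        ≈⟨ te ⟨
            t ∘ e        ∎)
      where
        open IsStablePushout S
        meet : ∀ {V} (e : V ⇒ _) → (u ∘ n) ∘ (x ∘ e) ≈ u ∘ (t ∘ e)
        meet e = trans assoc (trans (u ∘ˡ sym assoc) (extendˡ eq))

    -- Cover the domain by means of `s`. On each part `s` factors through a leg, so the previous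
    -- lemma applies, to the transposed square in the second case.
    pushoutOfIntersection-mono : {f : A ⇒ B} {m : A ⇒ C} {n : B ⇒ D} {g : C ⇒ D} {u : D ⇒ E} →
                                 IsStablePushout f m n g → Mono (u ∘ n) → Mono (u ∘ g) →
                                 IsPullback f m (u ∘ n) (u ∘ g) → Mono u
    pushoutOfIntersection-mono {n = n} {g} {u} S monoⁿ monoᵍ P s t eq =
      stablePushout-cover S
        (λ e y se → trans se (pushoutOfIntersection-leg S monoⁿ P y (t ∘ e)
                      (trans (u ∘ˡ sym se) (extendˡ eq))))
        (λ e y se → trans se
          (pushoutOfIntersection-leg (stablePushout-swap S) monoᵍ (pullback-swap P) y (t ∘ e)
            (trans (u ∘ˡ sym se) (extendˡ eq))))

-- From adhesive arrows to Van Kampen squares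

module AdhesivityCriterion {o ℓ e : Level} (𝐗 : Category o ℓ e) where
  open Adhesivity 𝐗
  open HomReasoning 𝐗
  open PullbackProperties 𝐗
  open PushoutProperties 𝐗
  open StabilityProperties 𝐗

  module _ {p q : Level} (𝓜 : ArrowClass p) (𝓝 : ArrowClass q)
           (pullbacks : ∀ {B C D} (n : B ⇒ D) (g : C ⇒ D) → HasPullback n g)
           (preadhesive : IsPreadhesiveStructure 𝓜 𝓝)
           (split : ∀ {A B} (s : A ⇒ B) → SplitMono s → s ∈ 𝓜 × s ∈ 𝓝)
           (adhesive : ∀ {X Y} (m : X ⇒ Y) → m ∈ 𝓜 → IsAdhesiveArrow 𝓝 m)
           (unions : ClosedUnderUnions 𝓜 𝓝)
           where
    open IsPreadhesiveStructure preadhesive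

    private variable
      X Y Z W X₂ Y₂ : Obj
      m : X ⇒ Y

    𝓜⇒preadhesive : m ∈ 𝓜 → IsPreadhesiveArrow 𝓝 m
    𝓜⇒preadhesive {m = m} m∈𝓜 = adhesive m m∈𝓜 id m id (pullback-swap pullback-id)

    -- Preadhesiveness provides just one such pushout; the split monic comparison with it carries
    -- both properties to an arbitrary one.
    𝓜𝓝-pushout-stable×pullback : {m : X ⇒ Y} {n : X ⇒ Z} {i : Z ⇒ W} {j : Y ⇒ W} →
                                  m ∈ 𝓜 → n ∈ 𝓝 → IsPushout n m i j →
                                  IsStablePushout n m i j × IsPullback n m i j
    𝓜𝓝-pushout-stable×pullback {n = n} m∈𝓜 n∈𝓝 P =
      let _ , _ , _ , S , Q = 𝓜⇒preadhesive m∈𝓜 n n∈𝓝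
          _ , ψ-split , ψi , ψj = pushout-comparison P (IsStablePushout.isPushout S)
      in stablePushout-cancelMono (splitMono-mono ψ-split) ψi ψj P S
       , pullback-cancel (IsPushout.commute P) Q ψi ψj

    -- The pushout square relating the kernel pairs of `n` and `j`

    module KernelPairs
             {m : X ⇒ Y} {n : X ⇒ Z} {i : Z ⇒ W} {j : Y ⇒ W}
             {p₁ p₂ : X₂ ⇒ X} {q₁ q₂ : Y₂ ⇒ Y}
             {Δ : X ⇒ X₂} {δ : Y ⇒ Y₂} {k : X₂ ⇒ Y₂}
             (m∈𝓜 : m ∈ 𝓜) (n∈𝓝 : n ∈ 𝓝) (P : IsPushout n m i j)
             (Pₓ : IsPullback p₂ p₁ n n) (P_y : IsPullback q₂ q₁ j j)
             (p₁Δ : p₁ ∘ Δ ≈ id) (p₂Δ : p₂ ∘ Δ ≈ id)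
             (q₁δ : q₁ ∘ δ ≈ id) (q₂δ : q₂ ∘ δ ≈ id)
             (q₁k : q₁ ∘ k ≈ m ∘ p₁) (q₂k : q₂ ∘ k ≈ m ∘ p₂)
             where

      private
        stable : IsStablePushout n m i j
        stable = proj₁ (𝓜𝓝-pushout-stable×pullback m∈𝓜 n∈𝓝 P)

        square : IsPullback n m i j
        square = proj₂ (𝓜𝓝-pushout-stable×pullback m∈𝓜 n∈𝓝 P)

        -- This is the base change of the pushout along `j`: the arrow `i` pulls back to `m` by
        -- `square`, and `j` pulls back to the kernel pair projection `q₂`.
        cube : CubeOver n m i j
        cube = record
          { g′ = p₂ ; m′ = k ; n′ = m ; f′ = q₂ ; a = p₁ ; b = n ; c = q₁ ; d = j
          ; top-commute = sym q₂k
          ; ab-commute  = IsPullback.commute Pₓ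
          ; ac-commute  = q₁k
          ; bd-commute  = sym (IsPushout.commute P)
          ; cd-commute  = IsPullback.commute P_y
          }

        k-pullback : IsPullback k p₁ q₁ m
        k-pullback =
          cube-fourthPullback cube (IsPushout.commute P) Pₓ (pullback-swap square , P_y)

        cubeTop : IsPushout p₂ k m q₂
        cubeTop = IsStablePushout.stable stable cube (Pₓ , k-pullback)
                    (pullback-swap square , P_y)

        k∘Δ : k ∘ Δ ≈ δ ∘ m
        k∘Δ = pullback-jointlyMonic P_y (lemma q₂k p₂Δ q₂δ) (lemma q₁k p₁Δ q₁δ)
          where
            lemma : {q : Y₂ ⇒ Y} {p : X₂ ⇒ X} → q ∘ k ≈ m ∘ p → p ∘ Δ ≈ id → q ∘ δ ≈ id →
                    q ∘ (k ∘ Δ) ≈ q ∘ (δ ∘ m)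
            lemma α β γ = trans (extendˡ α) (trans (_ ∘ˡ β) (trans identityʳ (sym (cancelˡ γ))))

        k∈𝓜 : k ∈ 𝓜
        k∈𝓜 = 𝓜-pullbacks p₁ k m q₁ (pullback-swap k-pullback) m∈𝓜

        k-mono : Mono k
        k-mono = 𝓜-mono k k∈𝓜

        δ-mono : Mono δ
        δ-mono = splitMono-mono (q₁ , q₁δ)

        -- Pasted with `k-pullback`, the square becomes trivial, since `p₁` and `q₁` retract the
        -- diagonals.
        intersection : IsPullback Δ m k δ
        intersection = pullback-unpaste
          (pullback-swap k-pullback) (pullback-swap pullback-id) p₁Δ q₁δ k∘Δ

        union = 𝓜⇒preadhesive m∈𝓜 Δ (proj₂ (split Δ (p₁ , p₁Δ)))

        a = proj₁ (proj₂ union)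
        b = proj₁ (proj₂ (proj₂ union))

        union-stable : IsStablePushout Δ m a b
        union-stable = proj₁ (proj₂ (proj₂ (proj₂ union)))

        open IsPushout (IsStablePushout.isPushout union-stable) using ()
          renaming (universal to union-universal)

        u = proj₁ (union-universal k δ k∘Δ)

        u∘a : u ∘ a ≈ k
        u∘a = proj₁ (proj₁ (proj₂ (union-universal k δ k∘Δ)))

        u∘b : u ∘ b ≈ δ
        u∘b = proj₂ (proj₁ (proj₂ (union-universal k δ k∘Δ)))

        u-mono : Mono u
        u-mono = pushoutOfIntersection-mono pullbacks union-stable
          (mono-resp (sym u∘a) k-mono) (mono-resp (sym u∘b) δ-mono)
          -- Composing with `id` only rewrites `k` and `δ` as `u ∘ a` and `u ∘ b`.
          (pullback-postcompose-mono {u = id} (splitMono-mono (id , identityˡ))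
            intersection (trans identityˡ (sym u∘a)) (trans identityˡ (sym u∘b)))

        u∈𝓜 : u ∈ 𝓜
        u∈𝓜 = unions (record { arr = u ; mono = u-mono })
          ( record { arr = k ; mono = k-mono } , record { arr = δ ; mono = δ-mono }
          , k∈𝓜 , split δ (q₁ , q₁δ)
          , (a , u∘a) , (b , u∘b)
          -- The factorizations `s` and `t` through an upper bound agree on `X` because `w` is
          -- monic, so they glue along the pushout.
          , λ w (s , ws) (t , wt) →
              let open MonoInto w
                  v , (va , vb) , _ = union-universal s t (mono _ _
                    (trans (pullˡ ws) (trans k∘Δ (sym (pullˡ wt)))))
              in v , pushout-jointlyEpic (IsStablePushout.isPushout union-stable)
                       (trans (pullʳ va) (trans ws (sym u∘a)))
                       (trans (pullʳ vb) (trans wt (sym u∘b)))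
          )

        -- Since `p₂ ∘ Δ` and `(q₂ ∘ u) ∘ b` are identities, this square pasted after the union
        -- square is the trivial pushout on `m`; the union square cancels.
        union-pushout : IsPushout a p₂ (q₂ ∘ u) m
        union-pushout = pushout-swap (pushout-unpaste (IsStablePushout.isPushout union-stable)
          pushout-id p₂Δ (trans (pullʳ u∘b) q₂δ)
          (sym (trans (pullʳ u∘a) q₂k)))

        -- As a pullback of `n`, the projection `p₂` lies in `𝓝`, and `q₂ ∘ u` is its pushout along
        -- `a`.
        q₂∘u∈𝓝 : q₂ ∘ u ∈ 𝓝
        q₂∘u∈𝓝 = 𝓝-pushouts a p₂ (q₂ ∘ u) m union-pushout (𝓝-pullbacks p₁ p₂ n n
          (pullback-swap Pₓ) n∈𝓝)

        -- Both a and k become m when pushed out along p₂, so the comparison u becomes id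
        -- when pushed out along q₂ ∘ u; that is an 𝓜,𝓝-pushout, hence a pullback.
        u-pushout : IsPushout u (q₂ ∘ u) q₂ id
        u-pushout = pushout-unpaste union-pushout (pushout-swap cubeTop) u∘a identityˡ
          (sym identityˡ)

        u-iso : IsIso u
        u-iso = pullback-along-id
          (proj₂ (𝓜𝓝-pushout-stable×pullback u∈𝓜 q₂∘u∈𝓝 (pushout-swap u-pushout)))

      kernelPairs-pushout : IsPushout Δ m k δ
      kernelPairs-pushout =
        pushout-postcompose-iso u-iso (IsStablePushout.isPushout union-stable) u∘a u∘b

      kernelPairs-stablePushout×pullback : IsStablePushout Δ m k δ × IsPullback k p₁ q₁ m
      kernelPairs-stablePushout×pullback =
        proj₁ (𝓜𝓝-pushout-stable×pullback m∈𝓜 (proj₂ (split Δ (p₁ , p₁Δ))) kernelPairs-pushout)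
        , k-pullback

    -- Front faces of a cube whose top is a pushout

    module FrontFaces
             {m : X ⇒ Y} {n : X ⇒ Z} {i : Z ⇒ W} {j : Y ⇒ W}
             {X′ Y′ Z′ W′ : Obj}
             {m′ : X′ ⇒ Y′} {n′ : X′ ⇒ Z′} {i′ : Z′ ⇒ W′} {j′ : Y′ ⇒ W′}
             {x : X′ ⇒ X} {y : Y′ ⇒ Y} {z : Z′ ⇒ Z} {w : W′ ⇒ W}
             (m∈𝓜 : m ∈ 𝓜) (n∈𝓝 : n ∈ 𝓝)
             (P : IsPushout n m i j) (P′ : IsPushout n′ m′ i′ j′)
             (Pn : IsPullback n′ x z n) (Pm : IsPullback m′ x y m)
             (wi′ : w ∘ i′ ≈ i ∘ z) (wj′ : w ∘ j′ ≈ j ∘ y)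
             where

      private
        m′∈𝓜 : m′ ∈ 𝓜
        m′∈𝓜 = 𝓜-pullbacks x m′ m y (pullback-swap Pm) m∈𝓜

        n′∈𝓝 : n′ ∈ 𝓝
        n′∈𝓝 = 𝓝-pullbacks x n′ n z (pullback-swap Pn) n∈𝓝

        top-stable : IsStablePushout n′ m′ i′ j′
        top-stable = proj₁ (𝓜𝓝-pushout-stable×pullback m′∈𝓜 n′∈𝓝 P′)

        bottom : IsPullback n m i j
        bottom = proj₂ (𝓜𝓝-pushout-stable×pullback m∈𝓜 n∈𝓝 P)

        i-mono : Mono i
        i-mono = 𝓜-mono i (𝓜-pushouts n m i j P m∈𝓜)

      i-face : IsPullback i′ z w i
      i-face =
        let _ , p , r , Pi = pullbacks w i
            e , (pe , re) , _ = IsPullback.universal Pi i′ z wi′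
            p-mono = pullback-of-mono (pullback-swap Pi) i-mono
            -- Over `W`, the arrows `i` and `j` meet in `X`; hence `p` and `j′` meet in `X′`.
            en′-pullback = pullback-unpaste (pullback-swap Pi)
              (pullback-paste (pullback-swap Pm) bottom refl refl)
              (trans (pullˡ re) (IsPullback.commute Pn)) wj′
              (trans (pullˡ pe) (IsPushout.commute P′))
            -- Base change of the top along `p` leaves `Z′` in place and replaces `Y′` by `X′`, so
            -- `m′` becomes `id` and `e` is a pushout of it.
            e-iso = pushout-along-id (pushout-swap (IsStablePushout.stable top-stable
              (record
                { g′ = n′ ; m′ = id ; n′ = e ; f′ = e ∘ n′ ; a = id ; b = id ; c = m′ ; d = p
                ; top-commute = sym identityʳ
                ; ab-commute  = sym id-comm
                ; ac-commute  = refl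
                ; bd-commute  = trans pe (sym identityʳ)
                ; cd-commute  = trans (pullˡ pe) (IsPushout.commute P′)
                })
              (pullback-id , pullback-of-factor (𝓜-mono m′ m′∈𝓜) identityʳ)
              (pullback-of-factor p-mono pe , en′-pullback)))
        in pullback-precompose-iso e-iso Pi pe re

      j-comparison-iso : {Q : Obj} {h : Q ⇒ W′} {v : Q ⇒ Y} {e : Y′ ⇒ Q} →
                         IsPullback h v w j → h ∘ e ≈ j′ → v ∘ e ≈ y → IsIso e
      j-comparison-iso {h = h} {v} {e} Pj he ve
        -- The common domain of `ρ` and `r` is the pullback of `Y′` and `Y` over `W`.
        with _ , ρ , r , Pρ ← pullbacks h j′
        with _ , σ₂ , σ₁ , Pσ ← pullbacks n′ n′
        with _ , p₂ , p₁ , Pp ← pullbacks n n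
        with _ , q₂ , q₁ , Pq ← pullbacks j j
        with Δ , (p₂Δ , p₁Δ) , _ ← IsPullback.universal Pp id id refl
        with δ , (q₂δ , q₁δ) , _ ← IsPullback.universal Pq id id refl
        with k , (q₂k , q₁k) , _ ← IsPullback.universal Pq (m ∘ p₂) (m ∘ p₁) (begin
            j ∘ (m ∘ p₂)  ≈⟨ extendˡ (IsPushout.commute P) ⟨
            i ∘ (n ∘ p₂)  ≈⟨ i ∘ˡ IsPullback.commute Pp ⟩
            i ∘ (n ∘ p₁)  ≈⟨ extendˡ (IsPushout.commute P) ⟩
            j ∘ (m ∘ p₁)  ∎)
        with k′ , (ρk′ , rk′) , _ ← IsPullback.universal Pρ ((e ∘ m′) ∘ σ₂) (m′ ∘ σ₁) (begin
            h ∘ ((e ∘ m′) ∘ σ₂)  ≈⟨ h ∘ˡ assoc ⟩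
            h ∘ (e ∘ (m′ ∘ σ₂))  ≈⟨ pullˡ he ⟩
            j′ ∘ (m′ ∘ σ₂)       ≈⟨ extendˡ (IsPushout.commute P′) ⟨
            i′ ∘ (n′ ∘ σ₂)       ≈⟨ i′ ∘ˡ IsPullback.commute Pσ ⟩
            i′ ∘ (n′ ∘ σ₁)       ≈⟨ extendˡ (IsPushout.commute P′) ⟩
            j′ ∘ (m′ ∘ σ₁)       ∎)
        with θ , (q₂θ , q₁θ) , _ ← IsPullback.universal Pq (v ∘ ρ) (y ∘ r) (begin
            j ∘ (v ∘ ρ)   ≈⟨ extendˡ (IsPullback.commute Pj) ⟨
            w ∘ (h ∘ ρ)   ≈⟨ w ∘ˡ IsPullback.commute Pρ ⟩
            w ∘ (j′ ∘ r)  ≈⟨ extendˡ wj′ ⟩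
            j ∘ (y ∘ r)   ∎)
        =
        -- Since `i` pulls back along `j` to `m`, its lift `i′` pulls back along `h` to `e ∘ m′`.
        let Pem′ = pullback-unpaste (pullback-swap Pj)
              (pullback-paste (pullback-swap Pn) (pullback-swap bottom) refl refl)
              (trans (pullˡ ve) (IsPullback.commute Pm)) wi′
              (trans (pullˡ he) (sym (IsPushout.commute P′)))
            κ = record
              { g′ = σ₂ ; m′ = k′ ; n′ = e ∘ m′ ; f′ = ρ ; a = σ₁ ; b = n′ ; c = r ; d = h
              ; top-commute = sym ρk′
              ; ab-commute  = IsPullback.commute Pσ
              ; ac-commute  = rk′
              ; bd-commute  = IsPullback.commute Pem′
              ; cd-commute  = IsPullback.commute Pρ
              }
            Pk′ = cube-fourthPullback κ (IsPushout.commute P′) Pσ (Pem′ , Pρ)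
            right = IsStablePushout.stable top-stable κ (Pσ , Pk′) (Pem′ , Pρ)
            -- The square exhibits `r` as the base change of `q₁` along `y`, as needed to pull the
            -- kernel pair square back along `θ`.
            Pθ = pullback-unpaste Pq (pullback-paste Pρ (pullback-swap Pj) refl refl)
                   q₂θ (sym wj′) q₁θ
            S , Pk = KernelPairs.kernelPairs-stablePushout×pullback
                       m∈𝓜 n∈𝓝 P Pp Pq p₁Δ p₂Δ q₁δ q₂δ q₁k q₂k
            Δ′ , δ′ , σ₁Δ′ , rδ′ , θδ′ , left = stablePushout-retract S p₁Δ q₁δ Pk Pm Pk′ Pθ
            ρδ′ = pullback-jointlyMonic Pj
              (begin
                h ∘ (ρ ∘ δ′)   ≈⟨ extendˡ (IsPullback.commute Pρ) ⟩
                j′ ∘ (r ∘ δ′)  ≈⟨ j′ ∘ˡ rδ′ ⟩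
                j′ ∘ id        ≈⟨ identityʳ ⟩
                j′             ≈⟨ he ⟨
                h ∘ e          ∎)
              (begin
                v ∘ (ρ ∘ δ′)   ≈⟨ extendˡ q₂θ ⟨
                q₂ ∘ (θ ∘ δ′)  ≈⟨ q₂ ∘ˡ θδ′ ⟩
                q₂ ∘ (δ ∘ y)   ≈⟨ cancelˡ q₂δ ⟩
                y              ≈⟨ ve ⟨
                v ∘ e          ∎)
            -- By construction `Δ′` is a section of `σ₁` only; joint monicity of `e ∘ m′` and `n′`
            -- makes it a section of `σ₂` too.
            σ₂Δ′ = pullback-jointlyMonic Pem′
              (begin
                (e ∘ m′) ∘ (σ₂ ∘ Δ′)  ≈⟨ extendˡ ρk′ ⟨
                ρ ∘ (k′ ∘ Δ′)         ≈⟨ ρ ∘ˡ IsPushout.commute left ⟩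
                ρ ∘ (δ′ ∘ m′)         ≈⟨ pullˡ ρδ′ ⟩
                e ∘ m′                ≈⟨ identityʳ ⟨
                (e ∘ m′) ∘ id         ∎)
              (trans (extendˡ (IsPullback.commute Pσ)) (n′ ∘ˡ σ₁Δ′))
        -- The pasted square has `id` on top and `e` opposite to it.
        in pushout-along-id (pushout-paste left right σ₂Δ′ ρδ′)

      j-face : IsPullback j′ y w j
      j-face =
        let _ , _ , _ , Pj = pullbacks w j
            _ , (he , ve) , _ = IsPullback.universal Pj j′ y wj′
        in pullback-precompose-iso (j-comparison-iso Pj he ve) Pj he ve

    -- The Van Kampen property and adhesivity

    pushout-vanKampen : {m : X ⇒ Y} {n : X ⇒ Z} {i : Z ⇒ W} {j : Y ⇒ W} →
                        m ∈ 𝓜 → n ∈ 𝓝 → IsPushout n m i j → IsVanKampen n m i j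
    pushout-vanKampen m∈𝓜 n∈𝓝 P = record
      { isPushout = P
      ; vanKampen = λ κ back@(Pn , Pm) → let open CubeOver κ in mk⇔
          (λ top → FrontFaces.i-face m∈𝓜 n∈𝓝 P top Pn Pm bd-commute cd-commute
                 , FrontFaces.j-face m∈𝓜 n∈𝓝 P top Pn Pm bd-commute cd-commute)
          (IsStablePushout.stable (proj₁ (𝓜𝓝-pushout-stable×pullback m∈𝓜 n∈𝓝 P)) κ back)
      }

    isAdhesive : IsAdhesive 𝓜 𝓝
    isAdhesive = record
      { preadhesive  = preadhesive
      ; 𝓜-pullback   = λ m g _ → pullbacks m g
      ; 𝓜𝓝-pushout   = λ m n m∈𝓜 n∈𝓝 →
          let W , i , j , S , _ = 𝓜⇒preadhesive m∈𝓜 n n∈𝓝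
          in W , i , j , IsStablePushout.isPushout S
      ; 𝓜𝓝-vanKampen = λ m n i j → pushout-vanKampen
      }

theorem4p5 : {o ℓ e p q : Level} (𝐗 : Category o ℓ e) → let open Adhesivity 𝐗 in
    (𝓜 : ArrowClass p) (𝓝 : ArrowClass q) →
    (∀ {B C D} (n : B ⇒ D) (g : C ⇒ D) → HasPullback n g) →
    IsPreadhesiveStructure 𝓜 𝓝 →
    (∀ {A B} (s : A ⇒ B) → SplitMono s → s ∈ 𝓜 × s ∈ 𝓝) →
    (∀ {X Y} (m : X ⇒ Y) → m ∈ 𝓜 → IsAdhesiveArrow 𝓝 m) →
    ClosedUnderUnions 𝓜 𝓝 →
    IsAdhesive 𝓜 𝓝
theorem4p5 𝐗 = AdhesivityCriterion.isAdhesive 𝐗
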